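{- Let $d\ge 2$, and let $a=(a_0,a_1,a_2,\ldots)$ be an eventually periodic binary sequence (with entries in $\mathbb F_2$). For each $h\ge 0$ let $\varepsilon_h$ be the depth-dependent labeling of the complete rooted $d$-ary tree $T_h^{(d)}$ induced by $a$. Then there exist integers $h_0\ge 0$ and $p\ge 1$ such that, for each residue class $r$ modulo $p$, there are rational constants $c_r,b_r$ satisfying \[ \operatorname{null} M(T_h^{(d)},\varepsilon_h)=c_r d^h+b_r \] for all $h\ge h_0$ with $h\equiv r\pmod p$.
   Context: All matrices and vector spaces are over the two-element field $\mathbb F_2$, and $\operatorname{null}(M)=\dim\ker(M)$. $T_h^{(d)}$ is the complete rooted $d$-ary tree of height $h$: every non-leaf vertex has exactly $d$ children and every root-to-leaf path has length $h$. The depth-dependent labeling $\varepsilon_h$ of $T_h^{(d)}$ associated with $a$ assigns label $a_j$ to every vertex whose descendant subtree has height $j$; thus leaves receive label $a_0$, their parents $a_1$, and the root $a_h$. For a tree $T$ with labeling $\varepsilon:V(T)\to\mathbb F_2$, $M(T,\varepsilon)=A(T)+D_\varepsilon$, where $A(T)$ is the adjacency matrix over $\mathbb F_2$ and $D_\varepsilon$ is the diagonal matrix with diagonal vector $\varepsilon$. -}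

module Defs where

open import Data.Fin.Base using (Fin)
import Data.Fin.Properties as Fin
open import Data.List.Base using (List; []; _∷_; map; concat; foldr; allFin)
open import Data.List.Membership.Propositional using (_∈_)
open import Data.List.Membership.Propositional.Properties
  using (∈-map⁺; ∈-map⁻; ∈-concat⁺′; ∈-allFin)
import Data.List.Relation.Unary.All as All
import Data.List.Relation.Unary.All.Properties as All
import Data.List.Relation.Unary.AllPairs as AllPairs
import Data.List.Relation.Unary.AllPairs.Properties as AllPairs
open import Data.List.Relation.Unary.Any using (here; there)
open import Data.List.Relation.Unary.Unique.Propositional using (Unique)
import Data.List.Relation.Unary.Unique.Propositional.Properties as Unique
open import Data.Integer.Base using (+_)
open import Data.Nat.Base using (ℕ; zero; suc; _≤_; ∣_-_∣)
import Data.Nat.Base as ℕ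
open import Data.Nat.Divisibility using (_∣_)
open import Data.Parity.Base using (Parity; 0ℙ; 1ℙ; _+_; _*_)
open import Data.Product using (Σ-syntax; _×_; _,_)
open import Data.Rational.Base using (ℚ; _/_)
open import Data.Sum.Base using (_⊎_; inj₁; inj₂)
open import Relation.Binary.Definitions
  using (Decidable; DecidableEquality; Irreflexive; Symmetric)
open import Relation.Binary.PropositionalEquality
  using (_≡_; _≢_; _≗_; refl; sym; trans; cong)
open import Relation.Nullary using (¬_; Dec; yes; no; _⊎-dec_)
open import Relation.Nullary.Decidable using (map′)

-- Parity with its stdlib operations is the field with two elements.
F₂ : Set
F₂ = Parity

∑ : {A : Set} → List A → (A → F₂) → F₂
∑ xs f = foldr _+_ 0ℙ (map f xs)

syntax ∑ xs (λ x → e) = ∑[ x ∈ xs ] e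

-- A finite simple graph; `vertices` lists every vertex exactly once.
record Graph : Set₁ where
  field
    Vertex     : Set
    vertices   : List Vertex
    complete   : ∀ v → v ∈ vertices
    unique     : Unique vertices
    _≟_        : DecidableEquality Vertex
    Adj        : Vertex → Vertex → Set
    adj?       : Decidable Adj
    adj-sym    : Symmetric Adj
    adj-irrefl : Irreflexive _≡_ Adj

indicator : {P : Set} → Dec P → F₂
indicator (yes _) = 1ℙ
indicator (no _)  = 0ℙ

module _ (G : Graph) where
  open Graph G

  Vec : Set
  Vec = Vertex → F₂

  Matrix : Set
  Matrix = Vertex → Vertex → F₂

  Labeling : Set
  Labeling = Vertex → F₂

  adjacency : Matrix
  adjacency u v = indicator (adj? u v)

  diagonal : Labeling → Matrix
  diagonal ε u v = indicator (u ≟ v) * ε u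

  M : Labeling → Matrix
  M ε u v = adjacency u v + diagonal ε u v

  Ker : Matrix → Vec → Set
  Ker A x = ∀ u → ∑[ v ∈ vertices ] (A u v * x v) ≡ 0ℙ

  combination : ∀ {k} → (Fin k → F₂) → (Fin k → Vec) → Vec
  combination {k} c b v = ∑[ i ∈ allFin k ] (c i * b i v)

  LinearlyIndependent : ∀ {k} → (Fin k → Vec) → Set
  LinearlyIndependent b = ∀ c → (∀ v → combination c b v ≡ 0ℙ) → ∀ i → c i ≡ 0ℙ

  record IsBasis (U : Vec → Set) {k : ℕ} (b : Fin k → Vec) : Set where
    field
      member      : ∀ i → U (b i)
      independent : LinearlyIndependent b
      spanning    : ∀ x → U x → Σ[ c ∈ (Fin k → F₂) ] x ≗ combination c b

  HasDimension : (Vec → Set) → ℕ → Set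
  HasDimension U k = Σ[ b ∈ (Fin k → Vec) ] IsBasis U b

  -- `HasNullity A k` is the relational form of null(A) = k.
  HasNullity : Matrix → ℕ → Set
  HasNullity A = HasDimension (Ker A)

-- A vertex of the complete rooted d-ary tree of height h is a path of length at
-- most h starting at the root, each step choosing one of d children.
data Node (d : ℕ) : ℕ → Set where
  root  : ∀ {h} → Node d h
  child : ∀ {h} → Fin d → Node d h → Node d (suc h)

subtreeHeight : ∀ {d h} → Node d h → ℕ
subtreeHeight {h = h} root = h
subtreeHeight (child _ v)  = subtreeHeight v

data _ParentOf_ {d : ℕ} : ∀ {h} → Node d h → Node d h → Set where
  at-root : ∀ {h} {i : Fin d} → root {h = suc h} ParentOf child i root
  below   : ∀ {h} {i : Fin d} {u v : Node d h} →
            u ParentOf v → child i u ParentOf child i v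

nodes : ∀ d h → List (Node d h)
nodes d zero    = root ∷ []
nodes d (suc h) = root ∷ concat (map (λ i → map (child i) (nodes d h)) (allFin d))

module _ {d : ℕ} where

  nodes-complete : ∀ {h} (v : Node d h) → v ∈ nodes d h
  nodes-complete {zero}  root        = here refl
  nodes-complete {suc h} root        = here refl
  nodes-complete {suc h} (child i v) =
    there (∈-concat⁺′ (∈-map⁺ (child i) (nodes-complete v))
                      (∈-map⁺ (λ j → map (child j) (nodes d h)) (∈-allFin i)))

  child-injectiveˡ : ∀ {h i j} {u v : Node d h} → child i u ≡ child j v → i ≡ j
  child-injectiveˡ refl = refl

  child-injectiveʳ : ∀ {h i j} {u v : Node d h} → child i u ≡ child j v → u ≡ v
  child-injectiveʳ refl = refl

  nodes-unique : ∀ h → Unique (nodes d h)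
  nodes-unique zero    = All.[] AllPairs.∷ AllPairs.[]
  nodes-unique (suc h) =
    All.concat⁺ {xss = map (λ i → map (child i) (nodes d h)) (allFin d)}
      (All.map⁺ (All.universal
        (λ i → All.map⁺ {f = child i} (All.universal (λ _ ()) (nodes d h))) (allFin d)))
    AllPairs.∷
    Unique.concat⁺
      (All.map⁺ (All.universal (λ i → Unique.map⁺ child-injectiveʳ (nodes-unique h)) (allFin d)))
      (AllPairs.map⁺ (AllPairs.map disjoint (Unique.allFin⁺ d)))
    where
    disjoint : ∀ {i j : Fin d} → i ≢ j → ∀ {v} →
               ¬ (v ∈ map (child i) (nodes d h) × v ∈ map (child j) (nodes d h))
    disjoint i≢j (p , q) with ∈-map⁻ _ p | ∈-map⁻ _ q
    ... | _ , _ , e | _ , _ , e′ = i≢j (child-injectiveˡ (trans (sym e) e′))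

  _≟ᴺ_ : ∀ {h} → DecidableEquality (Node d h)
  root      ≟ᴺ root      = yes refl
  root      ≟ᴺ child _ _ = no λ ()
  child _ _ ≟ᴺ root      = no λ ()
  child i u ≟ᴺ child j v with i Fin.≟ j | u ≟ᴺ v
  ... | yes refl | yes refl = yes refl
  ... | no i≢j   | _        = no λ e → i≢j (child-injectiveˡ e)
  ... | yes _    | no u≢v   = no λ e → u≢v (child-injectiveʳ e)

  parentOf? : ∀ {h} → Decidable (_ParentOf_ {d} {h})
  parentOf? root        root                = no λ ()
  parentOf? root        (child _ root)      = yes at-root
  parentOf? root        (child _ (child _ _)) = no λ ()
  parentOf? (child _ _) root                = no λ ()
  parentOf? (child i u) (child j v) with i Fin.≟ j
  ... | yes refl = map′ below (λ { (below p) → p }) (parentOf? u v)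
  ... | no i≢j   = no λ { (below _) → i≢j refl }

  parentOf-irrefl : ∀ {h} {v : Node d h} → ¬ (v ParentOf v)
  parentOf-irrefl (below p) = parentOf-irrefl p

completeTree : ℕ → ℕ → Graph
completeTree d h = record
  { Vertex     = Node d h
  ; vertices   = nodes d h
  ; complete   = nodes-complete
  ; unique     = nodes-unique h
  ; _≟_        = _≟ᴺ_
  ; Adj        = λ u v → (u ParentOf v) ⊎ (v ParentOf u)
  ; adj?       = λ u v → parentOf? u v ⊎-dec parentOf? v u
  ; adj-sym    = λ { (inj₁ p) → inj₂ p ; (inj₂ p) → inj₁ p }
  ; adj-irrefl = λ { refl (inj₁ p) → parentOf-irrefl p
                   ; refl (inj₂ p) → parentOf-irrefl p }
  }

depthLabeling : (ℕ → F₂) → ∀ d h → Labeling (completeTree d h)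
depthLabeling a d h v = a (subtreeHeight v)

EventuallyPeriodic : (ℕ → F₂) → Set
EventuallyPeriodic a =
  Σ[ n₀ ∈ ℕ ] Σ[ q ∈ ℕ ] (1 ≤ q × (∀ n → n₀ ≤ n → a (n ℕ.+ q) ≡ a n))

_≡_[mod_] : ℕ → ℕ → ℕ → Set
m ≡ n [mod p ] = p ∣ ∣ m - n ∣

toℚ : ℕ → ℚ
toℚ n = + n / 1

{-# OPTIONS --safe #-}
module Submission where

-- Consider the vectors on a tree of height h that satisfy all equations of the kernel
-- except the one at the root.  The pairs (value at the root, residual of the root
-- equation) that they realise form a line in F₂², one of three, and the line at height
-- h + 1 is a function of the line at height h and of a (h + 1).  The dimension n h of the
-- space of those with pair (0 , 0) satisfies n (h + 1) = d · n h + w h, where w h depends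
-- only on the line at height h.  By the pigeonhole principle the lines are eventually
-- periodic, hence so is w, and along a residue class modulo the period p the recurrence
-- becomes n ↦ dᵖ · n + C with constant C, whose solutions are affine in dʰ.

open import Defs
open import Data.Empty using (⊥-elim)
open import Data.Fin.Base using (Fin; zero; suc; toℕ)
import Data.Fin.Properties as Fin
import Data.Integer.Base as ℤ
import Data.Integer.Properties as ℤ
open import Data.List.Base using (List; []; _∷_; map; concat; foldr; allFin; tabulate; _++_)
open import Data.List.Properties using (map-tabulate)
open import Data.Nat.Base using (ℕ; zero; suc; _≤_; _≤′_; ≤′-refl; ≤′-step; _^_)
import Data.Nat.Base as ℕ
open import Data.Nat.Divisibility using (divides)
import Data.Nat.Properties as ℕ
open import Data.Nat.Solver using (module +-*-Solver)
open import Data.Parity.Base using (0ℙ; 1ℙ) renaming (_+_ to infixl 6 _⊕_; _*_ to infixl 7 _⊗_)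
import Data.Parity.Properties as ℙ
open import Data.Product using (Σ-syntax; _×_; _,_; proj₁; proj₂)
open import Data.Product.Function.NonDependent.Propositional using (_×-↔_)
open import Data.Rational.Base using (ℚ; _+_; _*_; -_; 1/_; 1ℚ)
import Data.Rational.Base as ℚ
import Data.Rational.Properties as ℚ
import Data.Rational.Solver as ℚ
open import Data.Rational.Unnormalised.Base as ℚᵘ using (mkℚᵘ; *≡*)
import Data.Rational.Unnormalised.Properties as ℚᵘ
open import Data.Sum.Base as Sum using (_⊎_; inj₁; inj₂; [_,_]′)
open import Data.Sum.Function.Propositional using (_⊎-↔_)
import Data.Vec.Functional as Vector
open import Function.Base using (_∘_; const; id)
open import Function.Bundles using (_↔_; module Inverse)
open import Function.Properties.Inverse using (↔-refl; ↔-sym; ↔-trans)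
open import Relation.Binary.PropositionalEquality
open import Relation.Nullary using (¬_; Dec; yes; no)
open import Algebra.Properties.CommutativeSemigroup ℙ.+-commutativeSemigroup using (interchange)
open import Algebra.Properties.Semiring.Sum ℙ.+-*-semiring
  using (sum; sum-cong-≗; sum-replicate-zero; ∑-distrib-+; *-distribʳ-sum)

open ≡-Reasoning

-- Sums and indicators over F₂.

sum-zero : ∀ {n} {f : Fin n → F₂} → (∀ i → f i ≡ 0ℙ) → sum f ≡ 0ℙ
sum-zero {n} f≗0 = trans (sum-cong-≗ f≗0) (sum-replicate-zero n)

sum-single : ∀ {n} (f : Fin n → F₂) i → (∀ j → i ≢ j → f j ≡ 0ℙ) → sum f ≡ f i
sum-single f zero    off =
  trans (cong (f zero ⊕_) (sum-zero λ j → off (suc j) λ ())) (ℙ.+-identityʳ (f zero))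
sum-single f (suc i) off =
  cong₂ _⊕_ (off zero λ ()) (sum-single (f ∘ suc) i λ j i≢j → off (suc j) (i≢j ∘ Fin.suc-injective))

∑-allFin : ∀ n (f : Fin n → F₂) → ∑ (allFin n) f ≡ sum f
∑-allFin n f = trans (cong (foldr _⊕_ 0ℙ) (map-tabulate id f)) (foldr-tabulate f)
  where
  foldr-tabulate : ∀ {n} (f : Fin n → F₂) → foldr _⊕_ 0ℙ (tabulate f) ≡ sum f
  foldr-tabulate {zero}  f = refl
  foldr-tabulate {suc n} f = cong (f zero ⊕_) (foldr-tabulate (f ∘ suc))

∑-cong : ∀ {A : Set} (xs : List A) {f g : A → F₂} → f ≗ g → ∑ xs f ≡ ∑ xs g
∑-cong []       f≗g = refl
∑-cong (x ∷ xs) f≗g = cong₂ _⊕_ (f≗g x) (∑-cong xs f≗g)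

∑-zero : ∀ {A : Set} (xs : List A) {f : A → F₂} → (∀ x → f x ≡ 0ℙ) → ∑ xs f ≡ 0ℙ
∑-zero []       f≗0 = refl
∑-zero (x ∷ xs) f≗0 = cong₂ _⊕_ (f≗0 x) (∑-zero xs f≗0)

∑-map : ∀ {A B : Set} (g : A → B) xs (f : B → F₂) → ∑ (map g xs) f ≡ ∑ xs (f ∘ g)
∑-map g []       f = refl
∑-map g (x ∷ xs) f = cong (f (g x) ⊕_) (∑-map g xs f)

∑-++ : ∀ {A : Set} (xs ys : List A) f → ∑ (xs ++ ys) f ≡ ∑ xs f ⊕ ∑ ys f
∑-++ []       ys f = refl
∑-++ (x ∷ xs) ys f = trans (cong (f x ⊕_) (∑-++ xs ys f)) (sym (ℙ.+-assoc (f x) _ _))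

∑-concat : ∀ {A : Set} (xss : List (List A)) f → ∑ (concat xss) f ≡ ∑ xss (λ xs → ∑ xs f)
∑-concat []         f = refl
∑-concat (xs ∷ xss) f = trans (∑-++ xs (concat xss) f) (cong (∑ xs f ⊕_) (∑-concat xss f))

indicator-cong : ∀ {P Q : Set} (p? : Dec P) (q? : Dec Q) → (P → Q) → (Q → P) →
                 indicator p? ≡ indicator q?
indicator-cong (yes p) (yes q) f g = refl
indicator-cong (yes p) (no ¬q) f g = ⊥-elim (¬q (f p))
indicator-cong (no ¬p) (yes q) f g = ⊥-elim (¬p (g q))
indicator-cong (no ¬p) (no ¬q) f g = refl

indicator-no : ∀ {P : Set} (p? : Dec P) → ¬ P → indicator p? ≡ 0ℙ
indicator-no (yes p) ¬p = ⊥-elim (¬p p)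
indicator-no (no _)  ¬p = refl

-- Additive maps, and bases obtained from parametrisations.

δ : ∀ {n} → Fin n → Fin n → F₂
δ i j = indicator (i Fin.≟ j)

Additive : ∀ {n} → ((Fin n → F₂) → F₂) → Set
Additive {n} φ = ∀ (c c′ : Fin n → F₂) → φ (λ i → c i ⊕ c′ i) ≡ φ c ⊕ φ c′

additive-zero : ∀ {n} {φ : (Fin n → F₂) → F₂} → Additive φ → φ (const 0ℙ) ≡ 0ℙ
additive-zero {φ = φ} add = trans (add (const 0ℙ) (const 0ℙ)) (ℙ.p+p≡0ℙ (φ (const 0ℙ)))

-- The only scalars are 0 and 1, so an additive map is linear and determined by its values on unit
-- vectors. The induction splits off coordinate zero and treats the rest through `φ ∘ extend`.
δ-expansion : ∀ {n} {φ : (Fin n → F₂) → F₂} →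
              (∀ {c c′} → c ≗ c′ → φ c ≡ φ c′) → Additive φ →
              ∀ c → sum (λ i → c i ⊗ φ (δ i)) ≡ φ c
δ-expansion {zero}  {φ} resp add c = trans (sym (additive-zero {φ = φ} add)) (resp λ ())
δ-expansion {suc n} {φ} resp add c = begin
  c zero ⊗ φ (δ zero) ⊕ sum (λ i → c (suc i) ⊗ φ (δ (suc i)))
    ≡⟨ cong₂ _⊕_ (scale (c zero)) (sum-cong-≗ λ i → cong (c (suc i) ⊗_) (resp (shift i))) ⟩
  φ (λ j → c zero ⊗ δ zero j) ⊕ sum (λ i → c (suc i) ⊗ φ (extend (δ i)))
    ≡⟨ cong (φ _ ⊕_) (δ-expansion {φ = φ ∘ extend} (λ e → resp (λ { zero → refl ; (suc j) → e j }))
         (λ c c′ → trans (resp λ { zero → refl ; (suc j) → refl }) (add (extend c) (extend c′)))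
         (c ∘ suc)) ⟩
  φ (λ j → c zero ⊗ δ zero j) ⊕ φ (extend (c ∘ suc))
    ≡⟨ add _ _ ⟨
  φ (λ j → c zero ⊗ δ zero j ⊕ extend (c ∘ suc) j)
    ≡⟨ resp (λ { zero    → trans (ℙ.+-identityʳ _) (ℙ.*-identityʳ (c zero))
               ; (suc j) → cong (_⊕ c (suc j)) (ℙ.*-zeroʳ (c zero)) }) ⟩
  φ c ∎
  where
  extend : (Fin n → F₂) → Fin (suc n) → F₂
  extend c = 0ℙ Vector.∷ c

  scale : ∀ t → t ⊗ φ (δ zero) ≡ φ (λ j → t ⊗ δ zero j)
  scale 0ℙ = sym (additive-zero {φ = φ} add)
  scale 1ℙ = refl

  shift : ∀ i → δ (suc i) ≗ extend (δ i)
  shift i zero    = refl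
  shift i (suc j) = indicator-cong (suc i Fin.≟ suc j) (i Fin.≟ j) Fin.suc-injective (cong suc)

module _ {G : Graph} {U : Vec G → Set} {J : Set} {k : ℕ} (J↔ : J ↔ Fin k)
         (φ : (J → F₂) → Vec G)
         (φ-cong : ∀ {c c′} → c ≗ c′ → φ c ≗ φ c′)
         (φ-+ : ∀ c c′ v → φ (λ j → c j ⊕ c′ j) v ≡ φ c v ⊕ φ c′ v)
         (φ-member : ∀ c → U (φ c))
         (φ-injective : ∀ c → (∀ v → φ c v ≡ 0ℙ) → ∀ j → c j ≡ 0ℙ)
         (φ-surjective : ∀ x → U x → Σ[ c ∈ (J → F₂) ] φ c ≗ x)
  where
  open Inverse J↔ using (to; from; strictlyInverseˡ; strictlyInverseʳ)

  -- The images of the unit vectors form a basis: by `δ-expansion` at each vertex, their combination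
  -- with coefficients `c` is `φ (c ∘ to)`. An arbitrary `J` admits index types that follow the
  -- recursion of the tree.
  hasDimension : HasDimension G U k
  hasDimension = b , record
    { member      = λ i → φ-member _
    ; independent = λ c c≡0 i → trans (sym (cong c (strictlyInverseˡ i)))
        (φ-injective (c ∘ to) (λ v → trans (sym (expand c v)) (c≡0 v)) (from i))
    ; spanning    = λ x Ux → let c , φc≗x = φ-surjective x Ux in
        c ∘ from , λ v → trans (sym (φc≗x v))
          (trans (φ-cong (λ j → sym (cong c (strictlyInverseʳ j))) v) (sym (expand (c ∘ from) v)))
    }
    where
    b : Fin k → Vec G
    b i = φ (δ i ∘ to)

    expand : ∀ c v → combination G c b v ≡ φ (c ∘ to) v
    expand c v = trans (∑-allFin k (λ i → c i ⊗ b i v))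
      (δ-expansion {φ = λ c → φ (c ∘ to) v} (λ e → φ-cong (λ j → e (to j)) v) (λ c c′ → φ-+ _ _ v) c)

-- The action of the matrix, branch by branch.

module TreeOperator (d : ℕ) (a : ℕ → F₂) where

  T : ℕ → Graph
  T = completeTree d

  A : ∀ h → Matrix (T h)
  A h = M (T h) (depthLabeling a d h)

  isRoot : ∀ {h} → Node d h → F₂
  isRoot root        = 1ℙ
  isRoot (child _ _) = 0ℙ

  -- The rows of A x, as if the root had a further neighbour with value p.
  apply : ∀ {h} → F₂ → Vec (T h) → Vec (T h)
  apply {zero}  p x root        = p ⊕ a zero ⊗ x root
  apply {suc h} p x root        = p ⊕ (a (suc h) ⊗ x root ⊕ sum (λ i → x (child i root)))
  apply {suc h} p x (child i u) = apply (x root) (x ∘ child i) u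

  ∑-nonroot : ∀ h (f : Node d (suc h) → F₂) →
    ∑ (concat (map (λ i → map (child i) (nodes d h)) (allFin d))) f ≡
    sum (λ i → ∑ (nodes d h) (f ∘ child i))
  ∑-nonroot h f = begin
    ∑ (concat (map (λ i → map (child i) (nodes d h)) (allFin d))) f
      ≡⟨ ∑-concat (map (λ i → map (child i) (nodes d h)) (allFin d)) f ⟩
    ∑ (map (λ i → map (child i) (nodes d h)) (allFin d)) (λ xs → ∑ xs f)
      ≡⟨ ∑-map _ (allFin d) _ ⟩
    ∑ (allFin d) (λ i → ∑ (map (child i) (nodes d h)) f)
      ≡⟨ ∑-allFin d _ ⟩
    sum (λ i → ∑ (map (child i) (nodes d h)) f)
      ≡⟨ sum-cong-≗ (λ i → ∑-map (child i) (nodes d h) f) ⟩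
    sum (λ i → ∑ (nodes d h) (f ∘ child i)) ∎

  root-row : ∀ {h} (x : Vec (T (suc h))) i →
    ∑[ w ∈ nodes d h ] (A (suc h) root (child i w) ⊗ x (child i w)) ≡ x (child i root)
  root-row {zero}  x i = ℙ.+-identityʳ _
  root-row {suc h} x i = trans
    (cong (x (child i root) ⊕_)
      (trans (∑-nonroot h _) (sum-zero {n = d} λ j → ∑-zero (nodes d h) λ w → refl)))
    (ℙ.+-identityʳ _)

  root-column : ∀ {h} i (u : Node d h) → A (suc h) (child i u) root ≡ isRoot u
  root-column i root        = refl
  root-column i (child _ _) = refl

  same-branch : ∀ {h} i (u w : Node d h) → A (suc h) (child i u) (child i w) ≡ A h u w
  same-branch {h} i u w = cong₂ _⊕_
    (indicator-cong (Graph.adj? (T (suc h)) (child i u) (child i w)) (Graph.adj? (T h) u w)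
      (Sum.map (λ { (below p) → p }) λ { (below p) → p }) (Sum.map below below))
    (cong (_⊗ depthLabeling a d h u)
      (indicator-cong (child i u ≟ᴺ child i w) (u ≟ᴺ w) child-injectiveʳ (cong (child i))))

  other-branch : ∀ {h i j} (u w : Node d h) → i ≢ j → A (suc h) (child i u) (child j w) ≡ 0ℙ
  other-branch {h} {i} {j} u w i≢j = cong₂ _⊕_
    (indicator-no (Graph.adj? (T (suc h)) (child i u) (child j w))
      λ { (inj₁ (below _)) → i≢j refl ; (inj₂ (below _)) → i≢j refl })
    (cong (_⊗ depthLabeling a d h u)
      (indicator-no (child i u ≟ᴺ child j w) (i≢j ∘ child-injectiveˡ)))

  -- Seen from branch `i`, the root is the further neighbour: its column contributes
  -- `isRoot u ⊗ x root`. The other branches contribute nothing, and the branch itself falls under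
  -- the induction hypothesis.
  apply-correct : ∀ {h} p (x : Vec (T h)) u →
    isRoot u ⊗ p ⊕ ∑[ v ∈ nodes d h ] (A h u v ⊗ x v) ≡ apply p x u
  apply-correct {zero}  p x root = cong (p ⊕_) (ℙ.+-identityʳ _)
  apply-correct {suc h} p x root =
    cong (λ s → p ⊕ (a (suc h) ⊗ x root ⊕ s))
      (trans (∑-nonroot h _) (sum-cong-≗ (root-row x)))
  apply-correct {suc h} p x (child i u) = begin
    ∑[ v ∈ nodes d (suc h) ] (A (suc h) (child i u) v ⊗ x v)
      ≡⟨ cong₂ _⊕_ (cong (_⊗ x root) (root-column i u)) (∑-nonroot h λ v → A (suc h) (child i u) v ⊗ x v) ⟩
    isRoot u ⊗ x root ⊕ sum (λ j → ∑[ w ∈ nodes d h ] (A (suc h) (child i u) (child j w) ⊗ x (child j w)))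
      ≡⟨ cong (isRoot u ⊗ x root ⊕_) (sum-single _ i λ j i≢j → ∑-zero (nodes d h) λ w →
           cong (_⊗ x (child j w)) (other-branch u w i≢j)) ⟩
    isRoot u ⊗ x root ⊕ ∑[ w ∈ nodes d h ] (A (suc h) (child i u) (child i w) ⊗ x (child i w))
      ≡⟨ cong (isRoot u ⊗ x root ⊕_) (∑-cong (nodes d h) λ w →
           cong (_⊗ x (child i w)) (same-branch i u w)) ⟩
    isRoot u ⊗ x root ⊕ ∑[ w ∈ nodes d h ] (A h u w ⊗ x (child i w))
      ≡⟨ apply-correct (x root) (x ∘ child i) u ⟩
    apply (x root) (x ∘ child i) u ∎

  apply-ker : ∀ {h} (x : Vec (T h)) u → ∑[ v ∈ nodes d h ] (A h u v ⊗ x v) ≡ apply 0ℙ x u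
  apply-ker x u = trans (cong (_⊕ ∑[ v ∈ nodes d _ ] (A _ u v ⊗ x v)) (sym (ℙ.*-zeroʳ (isRoot u)))) (apply-correct 0ℙ x u)

-- Lines in the plane of root pairs.

-- The lines of F₂²: `finite b` is spanned by (1 , b) and `∞` by (0 , 1).  The pair
-- (rootValue s t , residual s t) is t times the spanning vector of s.
data State : Set where
  finite : F₂ → State
  ∞      : State

rootValue : State → F₂ → F₂
rootValue (finite _) t = t
rootValue ∞          t = 0ℙ

residual : State → F₂ → F₂
residual (finite b) t = b ⊗ t
residual ∞          t = t

state-determined : ∀ s {t} → rootValue s t ≡ 0ℙ → residual s t ≡ 0ℙ → t ≡ 0ℙ
state-determined (finite _) value≡0 _ = value≡0
state-determined ∞          _ res≡0   = res≡0

rootValue-+ : ∀ s t t′ → rootValue s (t ⊕ t′) ≡ rootValue s t ⊕ rootValue s t′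
rootValue-+ (finite _) t t′ = refl
rootValue-+ ∞          t t′ = refl

-- `parameter s` ranges over the t with residual s t ≡ 0ℙ.
free : State → ℕ
free (finite 0ℙ) = 1
free (finite 1ℙ) = 0
free ∞           = 0

parameter : ∀ s → (Fin (free s) → F₂) → F₂
parameter (finite 0ℙ) f = f zero
parameter (finite 1ℙ) f = 0ℙ
parameter ∞           f = 0ℙ

parameter-cong : ∀ s {f f′} → f ≗ f′ → parameter s f ≡ parameter s f′
parameter-cong (finite 0ℙ) f≗ = f≗ zero
parameter-cong (finite 1ℙ) f≗ = refl
parameter-cong ∞           f≗ = refl

parameter-+ : ∀ s f f′ → parameter s (λ j → f j ⊕ f′ j) ≡ parameter s f ⊕ parameter s f′
parameter-+ (finite 0ℙ) f f′ = refl
parameter-+ (finite 1ℙ) f f′ = refl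
parameter-+ ∞           f f′ = refl

parameter-injective : ∀ s f → parameter s f ≡ 0ℙ → ∀ j → f j ≡ 0ℙ
parameter-injective (finite 0ℙ) f f≡0 zero = f≡0

parameter-residual : ∀ s f → residual s (parameter s f) ≡ 0ℙ
parameter-residual (finite 0ℙ) f = refl
parameter-residual (finite 1ℙ) f = refl
parameter-residual ∞           f = refl

parameter-surjective : ∀ s t → residual s t ≡ 0ℙ →
                       Σ[ f ∈ (Fin (free s) → F₂) ] parameter s f ≡ t
parameter-surjective (finite 0ℙ) t res = const t , refl
parameter-surjective (finite 1ℙ) t res = (λ ()) , sym res
parameter-surjective ∞           t res = (λ ()) , sym res

-- One step of elimination, from the children to their parent.

sum-const : ∀ n t → sum {n} (const t) ≡ sum {n} (const 1ℙ) ⊗ t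
sum-const n t = sym (*-distribʳ-sum {n} t (const 1ℙ))

module Elimination (e : ℕ) where

  -- The parent is the further neighbour of each child, so every child has residual x, the parent's
  -- value. On `finite 0ℙ` this forces x = 0 and leaves the sum of the children arbitrary; on
  -- `finite 1ℙ` each child has value x, so the residual is (α + d) x; on `∞` the children have
  -- value 0 and the residual is α x.
  next : State → F₂ → State
  next (finite 0ℙ) α = ∞
  next (finite 1ℙ) α = finite (α ⊕ sum {suc e} (const 1ℙ))
  next ∞           α = finite α

  -- Over children in state `finite 0ℙ` the root value vanishes and the values at the
  -- children are constrained only through their sum, the residual t.
  extra : State → ℕ
  extra (finite 0ℙ) = e
  extra (finite 1ℙ) = 0
  extra ∞           = 0

  -- Parameters of the children. On `finite 0ℙ` child zero carries the correction that makes the sum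
  -- over all children equal to `t`.
  share : ∀ s → (Fin (extra s) → F₂) → F₂ → Fin (suc e) → F₂
  share (finite 0ℙ) f t zero    = t ⊕ sum f
  share (finite 0ℙ) f t (suc i) = f i
  share (finite 1ℙ) f t i       = t
  share ∞           f t i       = t

  share-cong : ∀ s {f f′} t → f ≗ f′ → share s f t ≗ share s f′ t
  share-cong (finite 0ℙ) t f≗ zero    = cong (t ⊕_) (sum-cong-≗ f≗)
  share-cong (finite 0ℙ) t f≗ (suc i) = f≗ i
  share-cong (finite 1ℙ) t f≗ i       = refl
  share-cong ∞           t f≗ i       = refl

  share-+ : ∀ s f f′ t t′ i →
            share s (λ j → f j ⊕ f′ j) (t ⊕ t′) i ≡ share s f t i ⊕ share s f′ t′ i
  share-+ (finite 0ℙ) f f′ t t′ zero    =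
    trans (cong (t ⊕ t′ ⊕_) (∑-distrib-+ f f′)) (interchange t t′ (sum f) (sum f′))
  share-+ (finite 0ℙ) f f′ t t′ (suc i) = refl
  share-+ (finite 1ℙ) f f′ t t′ i       = refl
  share-+ ∞           f f′ t t′ i       = refl

  share-injective : ∀ s f t → (∀ i → share s f t i ≡ 0ℙ) → ∀ j → f j ≡ 0ℙ
  share-injective (finite 0ℙ) f t share≡0 j = share≡0 (suc j)

  share-residual : ∀ s α f t i → residual s (share s f t i) ≡ rootValue (next s α) t
  share-residual (finite 0ℙ) α f t i = refl
  share-residual (finite 1ℙ) α f t i = refl
  share-residual ∞           α f t i = refl

  -- This is the row of the parent. On `finite 0ℙ` the coordinates `f` occur at their own children
  -- and again in the correction at child zero, so they cancel.
  share-balance : ∀ s α f t →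
    residual (next s α) t ≡
    α ⊗ rootValue (next s α) t ⊕ sum (λ i → rootValue s (share s f t i))
  share-balance (finite 0ℙ) α f t = sym (begin
    α ⊗ 0ℙ ⊕ (t ⊕ sum f ⊕ sum f) ≡⟨ cong₂ _⊕_ (ℙ.*-zeroʳ α) (ℙ.+-assoc t (sum f) (sum f)) ⟩
    t ⊕ (sum f ⊕ sum f)          ≡⟨ cong (t ⊕_) (ℙ.p+p≡0ℙ (sum f)) ⟩
    t ⊕ 0ℙ                       ≡⟨ ℙ.+-identityʳ t ⟩
    t                            ∎)
  share-balance (finite 1ℙ) α f t =
    trans (ℙ.*-distribʳ-+ t α _) (cong (α ⊗ t ⊕_) (sym (sum-const (suc e) t)))
  share-balance ∞           α f t = sym
    (trans (cong (α ⊗ t ⊕_) (sum-zero {suc e} λ i → refl)) (ℙ.+-identityʳ (α ⊗ t)))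

  -- On `finite 0ℙ` the parameter of the parent is the sum of those of the children, and `x`
  -- vanishes because child zero has residual 0. On the other lines the residual is the parameter
  -- itself, so all children have parameter `x`.
  share-surjective : ∀ s α x (τ : Fin (suc e) → F₂) → (∀ i → residual s (τ i) ≡ x) →
    Σ[ f ∈ (Fin (extra s) → F₂) ] Σ[ t ∈ F₂ ] (share s f t ≗ τ × rootValue (next s α) t ≡ x)
  share-surjective (finite 0ℙ) α x τ res = τ ∘ suc , τ zero ⊕ sum (τ ∘ suc) , share≗τ , res zero
    where
    share≗τ : share (finite 0ℙ) (τ ∘ suc) (τ zero ⊕ sum (τ ∘ suc)) ≗ τ
    share≗τ zero    = begin
      τ zero ⊕ sum (τ ∘ suc) ⊕ sum (τ ∘ suc)   ≡⟨ ℙ.+-assoc (τ zero) _ _ ⟩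
      τ zero ⊕ (sum (τ ∘ suc) ⊕ sum (τ ∘ suc)) ≡⟨ cong (τ zero ⊕_) (ℙ.p+p≡0ℙ (sum (τ ∘ suc))) ⟩
      τ zero ⊕ 0ℙ                              ≡⟨ ℙ.+-identityʳ (τ zero) ⟩
      τ zero                                   ∎
    share≗τ (suc i) = refl
  share-surjective (finite 1ℙ) α x τ res = (λ ()) , x , (λ i → sym (res i)) , refl
  share-surjective ∞           α x τ res = (λ ()) , x , (λ i → sym (res i)) , refl

  -- Parametrisation of the solutions on the tree, and the nullity.

  module _ (a : ℕ → F₂) where
    open TreeOperator (suc e) a

    state : ℕ → State
    state zero    = finite (a zero)
    state (suc h) = next (state h) (a (suc h))

    -- Coordinates of the vectors with pair (0 , 0) at the root; the parameter along the line is
    -- kept apart.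
    Index : ℕ → Set
    Index zero    = Fin 0
    Index (suc h) = Fin (suc e) × Index h ⊎ Fin (extra (state h))

    count : ℕ → ℕ
    count zero    = 0
    count (suc h) = suc e ℕ.* count h ℕ.+ extra (state h)

    Index↔Fin : ∀ h → Index h ↔ Fin (count h)
    Index↔Fin zero    = ↔-refl
    Index↔Fin (suc h) = ↔-trans
      (↔-trans (↔-refl ×-↔ Index↔Fin h) (↔-sym Fin.*↔×) ⊎-↔ ↔-refl) (↔-sym Fin.+↔⊎)

    solution : ∀ {h} → (Index h → F₂) → F₂ → Vec (T h)
    solution {h}     c t root        = rootValue (state h) t
    solution {suc h} c t (child i u) =
      solution (λ j → c (inj₁ (i , j))) (share (state h) (c ∘ inj₂) t i) u

    solution-cong : ∀ {h c c′} t → c ≗ c′ → solution {h} c t ≗ solution c′ t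
    solution-cong         t c≗c′ root        = refl
    solution-cong {suc h} {c} {c′} t c≗c′ (child i u) = trans
      (solution-cong _ (λ j → c≗c′ (inj₁ (i , j))) u)
      (cong (λ τ → solution (λ j → c′ (inj₁ (i , j))) τ u)
        (share-cong (state h) t (c≗c′ ∘ inj₂) i))

    solution-+ : ∀ {h} c c′ t t′ (u : Node (suc e) h) →
      solution (λ j → c j ⊕ c′ j) (t ⊕ t′) u ≡ solution c t u ⊕ solution c′ t′ u
    solution-+ {h}     c c′ t t′ root        = rootValue-+ (state h) t t′
    solution-+ {suc h} c c′ t t′ (child i u) = trans
      (cong (λ τ → solution (λ j → c (inj₁ (i , j)) ⊕ c′ (inj₁ (i , j))) τ u)
        (share-+ (state h) (c ∘ inj₂) (c′ ∘ inj₂) t t′ i))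
      (solution-+ (λ j → c (inj₁ (i , j))) (λ j → c′ (inj₁ (i , j))) _ _ u)

    -- The row at the root is `share-balance`. In a branch the outside value is the root value,
    -- which by `share-residual` is the residual of that branch.
    solution-sound : ∀ {h} c t (u : Node (suc e) h) →
      apply (residual (state h) t) (solution c t) u ≡ 0ℙ
    solution-sound {zero}  c t root = ℙ.p+p≡0ℙ (a zero ⊗ t)
    solution-sound {suc h} c t root =
      trans (cong (residual (state (suc h)) t ⊕_)
              (sym (share-balance (state h) (a (suc h)) (c ∘ inj₂) t)))
        (ℙ.p+p≡0ℙ (residual (state (suc h)) t))
    solution-sound {suc h} c t (child i u) =
      subst (λ p → apply p (solution c t ∘ child i) u ≡ 0ℙ)
        (share-residual (state h) (a (suc h)) (c ∘ inj₂) t i)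
        (solution-sound (λ j → c (inj₁ (i , j))) (share (state h) (c ∘ inj₂) t i) u)

    -- The pair at the root is (0 , 0), so `t` vanishes. As the root value is zero, each branch
    -- again has residual zero, and induction kills its share and coordinates; vanishing shares kill
    -- the extra coordinates.
    solution-injective : ∀ {h} c t → (∀ u → solution {h} c t u ≡ 0ℙ) →
      residual (state h) t ≡ 0ℙ → t ≡ 0ℙ × (∀ j → c j ≡ 0ℙ)
    solution-injective {zero}  c t sol≡0 res≡0 =
      state-determined (state zero) (sol≡0 root) res≡0 , λ ()
    solution-injective {suc h} c t sol≡0 res≡0 =
      state-determined (state (suc h)) (sol≡0 root) res≡0 ,
      λ { (inj₁ (i , j)) → proj₂ (branch i) j
        ; (inj₂ j)       → share-injective (state h) (c ∘ inj₂) t (proj₁ ∘ branch) j }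
      where
      branch : ∀ i → share (state h) (c ∘ inj₂) t i ≡ 0ℙ × (∀ j → c (inj₁ (i , j)) ≡ 0ℙ)
      branch i = solution-injective _ _ (sol≡0 ∘ child i)
        (trans (share-residual (state h) (a (suc h)) (c ∘ inj₂) t i) (sol≡0 root))

    -- By induction each branch is a solution with outside value `x root`. All branches thus have
    -- the same residual, `share-surjective` joins their parameters, and the root row fixes the
    -- residual.
    solution-surjective : ∀ {h} p (x : Vec (T h)) → (∀ u → apply p x u ≡ 0ℙ) →
      Σ[ c ∈ (Index h → F₂) ] Σ[ t ∈ F₂ ] (solution c t ≗ x × residual (state h) t ≡ p)
    solution-surjective {zero}  p x eq =
      (λ ()) , x root , (λ { root → refl }) ,
      sym (ℙ.+-cancelʳ-≡ y p _ (trans (eq root) (sym (ℙ.p+p≡0ℙ y))))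
      where
      y : F₂
      y = a zero ⊗ x root
    solution-surjective {suc h} p x eq = c , t , sol≗x , res≡p
      where
      branch : ∀ i → Σ[ c ∈ (Index h → F₂) ] Σ[ t ∈ F₂ ]
                     (solution c t ≗ x ∘ child i × residual (state h) t ≡ x root)
      branch i = solution-surjective (x root) (x ∘ child i) (eq ∘ child i)

      τ : Fin (suc e) → F₂
      τ i = proj₁ (proj₂ (branch i))

      shared = share-surjective (state h) (a (suc h)) (x root) τ
                 (λ i → proj₂ (proj₂ (proj₂ (branch i))))
      f       = proj₁ shared
      t       = proj₁ (proj₂ shared)
      share≗τ = proj₁ (proj₂ (proj₂ shared))
      value≡x = proj₂ (proj₂ (proj₂ shared))

      c : Index (suc h) → F₂
      c (inj₁ (i , j)) = proj₁ (branch i) j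
      c (inj₂ j)       = f j

      sol≗x : solution c t ≗ x
      sol≗x root        = value≡x
      sol≗x (child i u) = trans (cong (λ τ → solution (proj₁ (branch i)) τ u) (share≗τ i))
        (proj₁ (proj₂ (proj₂ (branch i))) u)

      y : F₂
      y = a (suc h) ⊗ x root ⊕ sum (λ i → x (child i root))

      res≡p : residual (state (suc h)) t ≡ p
      res≡p = ℙ.+-cancelʳ-≡ _ _ p (begin
        residual (state (suc h)) t ⊕ y
          ≡⟨ cong (_⊕ y) (share-balance (state h) (a (suc h)) f t) ⟩
        a (suc h) ⊗ rootValue (state (suc h)) t
          ⊕ sum (λ i → rootValue (state h) (share (state h) f t i)) ⊕ y
          ≡⟨ cong (_⊕ y) (cong₂ (λ r s → a (suc h) ⊗ r ⊕ s) value≡x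
                           (sum-cong-≗ λ i → sol≗x (child i root))) ⟩
        y ⊕ y
          ≡⟨ ℙ.p+p≡0ℙ y ⟩
        0ℙ
          ≡⟨ eq root ⟨
        p ⊕ y ∎)

    -- The kernel is the case of residual 0, which leaves `free (state h)` parameters on the line
    -- beside the `count h` coordinates.
    nullity : ∀ h → HasNullity (T h) (A h) (count h ℕ.+ free (state h))
    nullity h = hasDimension
      (↔-trans (Index↔Fin h ⊎-↔ ↔-refl) (↔-sym Fin.+↔⊎))
      (λ c → solution (c ∘ inj₁) (parameter (state h) (c ∘ inj₂)))
      (λ {c} {c′} c≗c′ u → trans (solution-cong _ (c≗c′ ∘ inj₁) u)
        (cong (λ t → solution (c′ ∘ inj₁) t u) (parameter-cong (state h) (c≗c′ ∘ inj₂))))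
      (λ c c′ u → trans
        (cong (λ t → solution (λ j → c (inj₁ j) ⊕ c′ (inj₁ j)) t u)
          (parameter-+ (state h) (c ∘ inj₂) (c′ ∘ inj₂)))
        (solution-+ (c ∘ inj₁) (c′ ∘ inj₁) _ _ u))
      (λ c u → trans (apply-ker _ u)
        (subst (λ p → apply p (solution (c ∘ inj₁) (parameter (state h) (c ∘ inj₂))) u ≡ 0ℙ)
          (parameter-residual (state h) (c ∘ inj₂)) (solution-sound (c ∘ inj₁) _ u)))
      (λ c sol≡0 → let t≡0 , c≡0 = solution-injective (c ∘ inj₁) _ sol≡0
                                     (parameter-residual (state h) (c ∘ inj₂)) in
        λ { (inj₁ j) → c≡0 j ; (inj₂ j) → parameter-injective (state h) (c ∘ inj₂) t≡0 j })
      (λ x x∈ker → let c , t , sol≗x , res≡0 = solution-surjective 0ℙ x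
                         (λ u → trans (sym (apply-ker x u)) (x∈ker u))
                       f , param≡t = parameter-surjective (state h) t res≡0 in
        [ c , f ]′ , λ u → trans (cong (λ t → solution c t u) param≡t) (sol≗x u))

-- Passage from natural to rational numbers.

toℚᵘ-toℚ : ∀ n → ℚ.toℚᵘ (toℚ n) ℚᵘ.≃ mkℚᵘ (ℤ.+ n) 0
toℚᵘ-toℚ n = ℚ.toℚᵘ-fromℚᵘ (mkℚᵘ (ℤ.+ n) 0)

toℚ-+ : ∀ m n → toℚ (m ℕ.+ n) ≡ toℚ m + toℚ n
toℚ-+ m n = ℚ.toℚᵘ-injective
  (ℚᵘ.≃-trans (toℚᵘ-toℚ (m ℕ.+ n))
  (ℚᵘ.≃-trans (*≡* (cong (ℤ._* ℤ.1ℤ)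
                     (sym (cong₂ ℤ._+_ (ℤ.*-identityʳ (ℤ.+ m)) (ℤ.*-identityʳ (ℤ.+ n))))))
  (ℚᵘ.≃-sym (ℚᵘ.≃-trans (ℚ.toℚᵘ-homo-+ (toℚ m) (toℚ n))
                        (ℚᵘ.+-cong (toℚᵘ-toℚ m) (toℚᵘ-toℚ n))))))

toℚ-* : ∀ m n → toℚ (m ℕ.* n) ≡ toℚ m * toℚ n
toℚ-* m n = ℚ.toℚᵘ-injective
  (ℚᵘ.≃-trans (toℚᵘ-toℚ (m ℕ.* n))
  (ℚᵘ.≃-trans (*≡* (cong (ℤ._* ℤ.1ℤ) (ℤ.pos-* m n)))
  (ℚᵘ.≃-sym (ℚᵘ.≃-trans (ℚ.toℚᵘ-homo-* (toℚ m) (toℚ n))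
                        (ℚᵘ.*-cong (toℚᵘ-toℚ m) (toℚᵘ-toℚ n))))))

module _ (Q W A v : ℕ) .{{_ : ℕ.NonZero Q}} where

  instance
    toℚ-nonZero : ℚ.NonZero (toℚ Q)
    toℚ-nonZero = ℚ.pos⇒nonZero (toℚ Q) {{ℚ.normalize-pos Q 1}}

  slope intercept : ℚ
  slope     = toℚ W * 1/ toℚ Q
  intercept = toℚ v + - (toℚ A * 1/ toℚ Q)

  -- Division by `Q`. Both sides of the hypothesis are sums, so nothing is subtracted before the
  -- passage to ℚ.
  solve-affine : ∀ k x → Q ℕ.* k ℕ.+ A ≡ W ℕ.* x ℕ.+ Q ℕ.* v → toℚ k ≡ slope * toℚ x + intercept
  solve-affine k x eq = begin
    toℚ k
      ≡⟨ ℚ.*-identityʳ (toℚ k) ⟨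
    toℚ k * 1ℚ
      ≡⟨ cong (toℚ k *_) q*i≡1 ⟨
    toℚ k * (q * i)
      ≡⟨ solve 4 (λ k q i A → k :* (q :* i) := (q :* k :+ A) :* i :+ :- (A :* i))
           refl (toℚ k) q i (toℚ A) ⟩
    (q * toℚ k + toℚ A) * i + - (toℚ A * i)
      ≡⟨ cong (λ s → s * i + - (toℚ A * i)) eqℚ ⟩
    (toℚ W * toℚ x + q * toℚ v) * i + - (toℚ A * i)
      ≡⟨ solve 6 (λ W x q v i A → (W :* x :+ q :* v) :* i :+ :- (A :* i) :=
                                  W :* i :* x :+ (v :* (q :* i) :+ :- (A :* i)))
           refl (toℚ W) (toℚ x) q (toℚ v) i (toℚ A) ⟩
    slope * toℚ x + (toℚ v * (q * i) + - (toℚ A * i))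
      ≡⟨ cong (λ s → slope * toℚ x + (s + - (toℚ A * i)))
           (trans (cong (toℚ v *_) q*i≡1) (ℚ.*-identityʳ (toℚ v))) ⟩
    slope * toℚ x + intercept ∎
    where
    open ℚ.+-*-Solver
    q i : ℚ
    q = toℚ Q
    i = 1/ toℚ Q
    q*i≡1 : q * i ≡ 1ℚ
    q*i≡1 = ℚ.*-inverseʳ q
    eqℚ : q * toℚ k + toℚ A ≡ toℚ W * toℚ x + q * toℚ v
    eqℚ = begin
      q * toℚ k + toℚ A             ≡⟨ cong (_+ toℚ A) (toℚ-* Q k) ⟨
      toℚ (Q ℕ.* k) + toℚ A         ≡⟨ toℚ-+ (Q ℕ.* k) A ⟨
      toℚ (Q ℕ.* k ℕ.+ A)           ≡⟨ cong toℚ eq ⟩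
      toℚ (W ℕ.* x ℕ.+ Q ℕ.* v)     ≡⟨ toℚ-+ (W ℕ.* x) (Q ℕ.* v) ⟩
      toℚ (W ℕ.* x) + toℚ (Q ℕ.* v) ≡⟨ cong₂ _+_ (toℚ-* W x) (toℚ-* Q v) ⟩
      toℚ W * toℚ x + q * toℚ v     ∎

-- Periodic sequences and affine recurrences.

PeriodicFrom : {A : Set} → ℕ → ℕ → (ℕ → A) → Set
PeriodicFrom N p f = ∀ {h} → N ≤ h → f (h ℕ.+ p) ≡ f h

periodic-multiple : ∀ {A : Set} {N p} {f : ℕ → A} →
                    PeriodicFrom N p f → ∀ m → PeriodicFrom N (m ℕ.* p) f
periodic-multiple {f = f} per zero    {h} N≤h = cong f (ℕ.+-identityʳ h)
periodic-multiple {N = N} {p} {f} per (suc m) {h} N≤h = begin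
  f (h ℕ.+ (p ℕ.+ m ℕ.* p)) ≡⟨ cong f (ℕ.+-assoc h p (m ℕ.* p)) ⟨
  f (h ℕ.+ p ℕ.+ m ℕ.* p)   ≡⟨ periodic-multiple {f = f} per m (ℕ.≤-trans N≤h (ℕ.m≤m+n h p)) ⟩
  f (h ℕ.+ p)               ≡⟨ per N≤h ⟩
  f h                       ∎

module AffineRecurrence (d : ℕ) (w u : ℕ → ℕ) (u-suc : ∀ h → u (suc h) ≡ d ℕ.* u h ℕ.+ w h) where

  -- The inhomogeneous terms collected over `m` steps from `h`: the sum over i < m of d^(m-1-i) · w
  -- (h + i).
  carry : ℕ → ℕ → ℕ
  carry h zero    = 0
  carry h (suc m) = d ℕ.* carry h m ℕ.+ w (h ℕ.+ m)

  u-+ : ∀ h m → u (h ℕ.+ m) ≡ d ^ m ℕ.* u h ℕ.+ carry h m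
  u-+ h zero    = trans (cong u (ℕ.+-identityʳ h))
    (sym (trans (ℕ.+-identityʳ _) (ℕ.*-identityˡ (u h))))
  u-+ h (suc m) = begin
    u (h ℕ.+ suc m)                        ≡⟨ cong u (ℕ.+-suc h m) ⟩
    u (suc (h ℕ.+ m))                      ≡⟨ u-suc (h ℕ.+ m) ⟩
    d ℕ.* u (h ℕ.+ m) ℕ.+ w (h ℕ.+ m)      ≡⟨ cong (λ y → d ℕ.* y ℕ.+ w (h ℕ.+ m)) (u-+ h m) ⟩
    d ℕ.* (d ^ m ℕ.* u h ℕ.+ carry h m) ℕ.+ w (h ℕ.+ m)
      ≡⟨ solve 5 (λ d e u c w → d :* (e :* u :+ c) :+ w := d :* e :* u :+ (d :* c :+ w))
           refl d (d ^ m) (u h) (carry h m) (w (h ℕ.+ m)) ⟩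
    d ^ suc m ℕ.* u h ℕ.+ carry h (suc m) ∎
    where open +-*-Solver

  module _ {N p : ℕ} (w-periodic : PeriodicFrom N p w) where

    carry-periodic : ∀ m → PeriodicFrom N p (λ h → carry h m)
    carry-periodic zero    {h} N≤h = refl
    carry-periodic (suc m) {h} N≤h = cong₂ (λ c y → d ℕ.* c ℕ.+ y) (carry-periodic m N≤h) (begin
      w (h ℕ.+ p ℕ.+ m) ≡⟨ cong w (+-swapʳ h p m) ⟩
      w (h ℕ.+ m ℕ.+ p) ≡⟨ w-periodic (ℕ.≤-trans N≤h (ℕ.m≤m+n h m)) ⟩
      w (h ℕ.+ m)       ∎)
      where
      +-swapʳ : ∀ a b c → a ℕ.+ b ℕ.+ c ≡ a ℕ.+ c ℕ.+ b
      +-swapʳ = solve 3 (λ a b c → a :+ b :+ c := a :+ c :+ b) refl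
        where open +-*-Solver

    -- For a fixed point z = −C/E of z ↦ (1 + E) z + C this is u j − z = (1 + E)ʲ (u 0 − z),
    -- multiplied by E so that neither subtraction nor division occurs.
    closed-form : ∀ {E} → d ^ p ≡ suc E → ∀ {b} → N ≤ b → ∀ j →
      E ℕ.* u (b ℕ.+ j ℕ.* p) ℕ.+ carry b p ≡ suc E ^ j ℕ.* (E ℕ.* u b ℕ.+ carry b p)
    closed-form {E} D≡ {b} N≤b zero    =
      trans (cong (λ h → E ℕ.* u h ℕ.+ carry b p) (ℕ.+-identityʳ b)) (sym (ℕ.*-identityˡ _))
    closed-form {E} D≡ {b} N≤b (suc j) = begin
      E ℕ.* u (b ℕ.+ (p ℕ.+ j ℕ.* p)) ℕ.+ carry b p
        ≡⟨ cong (λ h → E ℕ.* u h ℕ.+ carry b p)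
             (solve 3 (λ b p q → b :+ (p :+ q) := b :+ q :+ p) refl b p (j ℕ.* p)) ⟩
      E ℕ.* u (b ℕ.+ j ℕ.* p ℕ.+ p) ℕ.+ carry b p
        ≡⟨ cong (λ y → E ℕ.* y ℕ.+ carry b p) (trans (u-+ (b ℕ.+ j ℕ.* p) p)
             (cong₂ (λ D c → D ℕ.* u (b ℕ.+ j ℕ.* p) ℕ.+ c) D≡
               (periodic-multiple {f = λ h → carry h p} (carry-periodic p) j N≤b))) ⟩
      E ℕ.* (suc E ℕ.* u (b ℕ.+ j ℕ.* p) ℕ.+ carry b p) ℕ.+ carry b p
        ≡⟨ solve 3 (λ E y c → E :* ((con 1 :+ E) :* y :+ c) :+ c := (con 1 :+ E) :* (E :* y :+ c))
             refl E (u (b ℕ.+ j ℕ.* p)) (carry b p) ⟩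
      suc E ℕ.* (E ℕ.* u (b ℕ.+ j ℕ.* p) ℕ.+ carry b p)
        ≡⟨ cong (suc E ℕ.*_) (closed-form D≡ N≤b j) ⟩
      suc E ℕ.* (suc E ^ j ℕ.* (E ℕ.* u b ℕ.+ carry b p))
        ≡⟨ ℕ.*-assoc (suc E) (suc E ^ j) _ ⟨
      suc E ^ suc j ℕ.* (E ℕ.* u b ℕ.+ carry b p) ∎
      where open +-*-Solver

-- Eventual periodicity of the states.

code : State → Fin 3
code (finite 0ℙ) = zero
code (finite 1ℙ) = suc zero
code ∞           = suc (suc zero)

code-injective : ∀ s s′ → code s ≡ code s′ → s ≡ s′
code-injective (finite 0ℙ) (finite 0ℙ) eq = refl
code-injective (finite 1ℙ) (finite 1ℙ) eq = refl
code-injective ∞           ∞           eq = refl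
code-injective ∞           (finite 0ℙ) ()
code-injective ∞           (finite 1ℙ) ()

module _ (e : ℕ) (a : ℕ → F₂) where
  open Elimination e

  -- Among the states at the four indices n₀ + i q, i < 4, two agree, and their distance p is a
  -- positive multiple of q. Beyond n₀ the labels also repeat with period p, so the two runs receive
  -- the same labels and stay equal.
  state-periodic : EventuallyPeriodic a →
    Σ[ N ∈ ℕ ] Σ[ p ∈ ℕ ] (1 ≤ p × PeriodicFrom N p (state a))
  state-periodic (n₀ , q , 1≤q , a-periodic)
    with i , j , i<j , same ← Fin.pigeonhole {3} {4} ℕ.≤-refl
                                (λ i → code (state a (n₀ ℕ.+ toℕ i ℕ.* q)))
    = N , p , ℕ.*-mono-≤ (ℕ.m<n⇒0<n∸m i<j) 1≤q , λ N≤h → periodic (ℕ.≤⇒≤′ N≤h)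
    where
    m = toℕ j ℕ.∸ toℕ i
    p = m ℕ.* q
    N = n₀ ℕ.+ toℕ i ℕ.* q

    N+p : N ℕ.+ p ≡ n₀ ℕ.+ toℕ j ℕ.* q
    N+p = begin
      n₀ ℕ.+ toℕ i ℕ.* q ℕ.+ m ℕ.* q   ≡⟨ ℕ.+-assoc n₀ _ _ ⟩
      n₀ ℕ.+ (toℕ i ℕ.* q ℕ.+ m ℕ.* q) ≡⟨ cong (n₀ ℕ.+_) (ℕ.*-distribʳ-+ q (toℕ i) m) ⟨
      n₀ ℕ.+ (toℕ i ℕ.+ m) ℕ.* q       ≡⟨ cong (λ l → n₀ ℕ.+ l ℕ.* q) (ℕ.m+[n∸m]≡n (ℕ.<⇒≤ i<j)) ⟩
      n₀ ℕ.+ toℕ j ℕ.* q               ∎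

    periodic : ∀ {h} → N ≤′ h → state a (h ℕ.+ p) ≡ state a h
    periodic ≤′-refl = trans (cong (state a) N+p) (code-injective _ _ (sym same))
    periodic (≤′-step {h} N≤h) = cong₂ next (periodic N≤h)
      (periodic-multiple {f = a} (a-periodic _) m
        (ℕ.≤-trans (ℕ.m≤m+n n₀ _) (ℕ.m≤n⇒m≤1+n (ℕ.≤′⇒≤ N≤h))))

-- Residue classes and the affine formula.

residue-offset : ∀ {p} (r : Fin p) N {h} → suc N ℕ.* p ≤ h → h ≡ toℕ r [mod p ] →
  Σ[ j ∈ ℕ ] h ≡ (toℕ r ℕ.+ N ℕ.* p) ℕ.+ j ℕ.* p
residue-offset {p} r N {h} N*p≤h (divides l eq) = l ℕ.∸ N , (begin
  h                                                    ≡⟨ h≡ ⟩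
  toℕ r ℕ.+ l ℕ.* p                                    ≡⟨ cong (λ m → toℕ r ℕ.+ m ℕ.* p) (ℕ.m+[n∸m]≡n N≤l) ⟨
  toℕ r ℕ.+ (N ℕ.+ (l ℕ.∸ N)) ℕ.* p                    ≡⟨ cong (toℕ r ℕ.+_) (ℕ.*-distribʳ-+ p N (l ℕ.∸ N)) ⟩
  toℕ r ℕ.+ (N ℕ.* p ℕ.+ (l ℕ.∸ N) ℕ.* p)              ≡⟨ ℕ.+-assoc (toℕ r) _ _ ⟨
  toℕ r ℕ.+ N ℕ.* p ℕ.+ (l ℕ.∸ N) ℕ.* p                ∎)
  where
  r≤h : toℕ r ≤ h
  r≤h = ℕ.≤-trans (ℕ.<⇒≤ (Fin.toℕ<n r)) (ℕ.≤-trans (ℕ.m≤m+n p (N ℕ.* p)) N*p≤h)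

  h≡ : h ≡ toℕ r ℕ.+ l ℕ.* p
  h≡ = trans (sym (ℕ.m+[n∸m]≡n r≤h)) (cong (toℕ r ℕ.+_) (trans (sym (ℕ.m≤n⇒∣n-m∣≡n∸m r≤h)) eq))

  -- As h = r + l p with r < p, the bound on h gives (N + 1) p < (l + 1) p.
  N≤l : N ≤ l
  N≤l = ℕ.<⇒≤ (ℕ.≤-pred (ℕ.*-cancelʳ-< p (suc N) (suc l)
    (ℕ.≤-<-trans N*p≤h (subst (ℕ._< suc l ℕ.* p) (sym h≡) (ℕ.+-monoˡ-< (l ℕ.* p) (Fin.toℕ<n r))))))

theorem1p5 : (d : ℕ) → 2 ≤ d →
    (a : ℕ → F₂) → EventuallyPeriodic a →
    Σ[ h₀ ∈ ℕ ] Σ[ p ∈ ℕ ] (1 ≤ p ×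
    ((r : Fin p) → Σ[ cᵣ ∈ ℚ ] Σ[ bᵣ ∈ ℚ ]
    ((h : ℕ) → h₀ ≤ h → h ≡ toℕ r [mod p ] →
    Σ[ k ∈ ℕ ] (HasNullity (completeTree d h) (M (completeTree d h) (depthLabeling a d h)) k
    × toℚ k ≡ cᵣ * toℚ (d ^ h) + bᵣ))))
theorem1p5 d@(suc e) 2≤d a a-periodic with N , p , 1≤p , s-periodic ← state-periodic e a a-periodic =
  -- The base point `b` of a class is shifted by `N` periods to lie in the periodic range; the
  -- threshold is one period more, hence above every base point.
  suc N ℕ.* p , p , 1≤p , λ r → let b = toℕ r ℕ.+ N ℕ.* p in
    slope (Q b) (W b) (A b) (v b) {{Q≢0 b}} ,
    intercept (Q b) (W b) (A b) (v b) {{Q≢0 b}} ,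
    λ h h₀≤h h≡r → let j , h≡ = residue-offset r N h₀≤h h≡r in
      count a h ℕ.+ v h , nullity a h ,
      solve-affine (Q b) (W b) (A b) (v b) {{Q≢0 b}} (count a h ℕ.+ v h) (d ^ h)
        (subst (Relation b) (sym h≡) (relation b (N≤-base r) j))
  where
  open Elimination e
  open AffineRecurrence d (extra ∘ state a) (count a) (λ h → refl)

  E : ℕ
  E = ℕ.pred (d ^ p)

  v W Q A : ℕ → ℕ
  v h = free (state a h)
  W b = E ℕ.* count a b ℕ.+ carry b p
  Q b = E ℕ.* d ^ b
  A b = d ^ b ℕ.* carry b p

  instance
    p≢0 : ℕ.NonZero p
    p≢0 = ℕ.>-nonZero 1≤p

    -- Since d ≥ 2 and p ≥ 1, dᵖ is at least 2; division by `Q` rests on this.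
    E≢0 : ℕ.NonZero E
    E≢0 = ℕ.>-nonZero (ℕ.pred-mono-≤ (ℕ.≤-trans 2≤d
            (subst (_≤ d ^ p) (ℕ.*-identityʳ d) (ℕ.^-monoʳ-≤ d 1≤p))))

  Q≢0 : ∀ b → ℕ.NonZero (Q b)
  Q≢0 b = ℕ.m*n≢0 E (d ^ b) {{E≢0}} {{ℕ.m^n≢0 d b}}

  D≡1+E : d ^ p ≡ suc E
  D≡1+E = sym (ℕ.suc-pred (d ^ p) {{ℕ.m^n≢0 d p}})

  N≤-base : ∀ (r : Fin p) → N ≤ toℕ r ℕ.+ N ℕ.* p
  N≤-base r = ℕ.≤-trans (ℕ.m≤m*n N p) (ℕ.m≤n+m (N ℕ.* p) (toℕ r))

  Relation : ℕ → ℕ → Set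
  Relation b h = Q b ℕ.* (count a h ℕ.+ v h) ℕ.+ A b ≡
                 W b ℕ.* d ^ h ℕ.+ Q b ℕ.* v b

  -- `free` takes the same value at h = b + j p as at b. The rest is the closed form for `count`
  -- multiplied by dᵇ, since dᵇ (1 + E)ʲ = dʰ.
  relation : ∀ b → N ≤ b → ∀ j → Relation b (b ℕ.+ j ℕ.* p)
  relation b N≤b j = begin
    Q b ℕ.* (count a h ℕ.+ v h) ℕ.+ A b
      ≡⟨ cong (λ y → Q b ℕ.* (count a h ℕ.+ y) ℕ.+ A b)
           (cong free (periodic-multiple {f = state a} s-periodic j N≤b)) ⟩
    Q b ℕ.* (count a h ℕ.+ v b) ℕ.+ A b
      ≡⟨ solve 5 (λ E x u v c → E :* x :* (u :+ v) :+ x :* c := x :* (E :* u :+ c) :+ E :* x :* v)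
           refl E (d ^ b) (count a h) (v b) (carry b p) ⟩
    d ^ b ℕ.* (E ℕ.* count a h ℕ.+ carry b p) ℕ.+ Q b ℕ.* v b
      ≡⟨ cong (λ y → d ^ b ℕ.* y ℕ.+ Q b ℕ.* v b)
           (closed-form (λ N≤h → cong extra (s-periodic N≤h)) D≡1+E N≤b j) ⟩
    d ^ b ℕ.* (suc E ^ j ℕ.* W b) ℕ.+ Q b ℕ.* v b
      ≡⟨ cong (ℕ._+ Q b ℕ.* v b)
           (solve 3 (λ x y W → x :* (y :* W) := W :* (x :* y)) refl (d ^ b) (suc E ^ j) (W b)) ⟩
    W b ℕ.* (d ^ b ℕ.* suc E ^ j) ℕ.+ Q b ℕ.* v b
      ≡⟨ cong (λ y → W b ℕ.* y ℕ.+ Q b ℕ.* v b) power ⟨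
    W b ℕ.* d ^ h ℕ.+ Q b ℕ.* v b ∎
    where
    open +-*-Solver
    h : ℕ
    h = b ℕ.+ j ℕ.* p
    power : d ^ h ≡ d ^ b ℕ.* suc E ^ j
    power = begin
      d ^ (b ℕ.+ j ℕ.* p)     ≡⟨ ℕ.^-distribˡ-+-* d b (j ℕ.* p) ⟩
      d ^ b ℕ.* d ^ (j ℕ.* p) ≡⟨ cong (λ m → d ^ b ℕ.* d ^ m) (ℕ.*-comm j p) ⟩
      d ^ b ℕ.* d ^ (p ℕ.* j) ≡⟨ cong (d ^ b ℕ.*_) (ℕ.^-*-assoc d p j) ⟨
      d ^ b ℕ.* (d ^ p) ^ j   ≡⟨ cong (λ D → d ^ b ℕ.* D ^ j) D≡1+E ⟩
      d ^ b ℕ.* suc E ^ j     ∎
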